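{- For every integer $n\geq 3$, writing $f_q(n)$ for the total number of occurrences of the pattern $q$ in all permutations of $S_n(123,231,312)$, we have $$f_{132}(n)=f_{213}(n)=\binom{n+1}{4},\qquad f_{321}(n)=\frac{n(n-2)(n-1)^2}{12}.$$
   Context: $S_n$ is the set of permutations of $\{1,\dots,n\}$ written in one-line notation $\sigma=\sigma_1\sigma_2\cdots\sigma_n$. For $q\in S_k$, an occurrence of the pattern $q$ in $\sigma\in S_n$ is a choice of indices $i_1<i_2<\cdots<i_k$ in $\{1,\dots,n\}$ such that for all $1\le j,l\le k$, $q_j<q_l$ if and only if $\sigma_{i_j}<\sigma_{i_l}$. Let $f_q(\sigma)$ be the number of occurrences of $q$ in $\sigma$; $\sigma$ avoids $q$ if $f_q(\sigma)=0$. $S_n(123,231,312)$ is the set of permutations in $S_n$ avoiding all of $123$, $231$ and $312$, and $f_q(n)=\sum_{\sigma\in S_n(123,231,312)}f_q(\sigma)$. -}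

module Defs where

open import Data.Fin using (Fin; _<_; _≟_)
open import Data.Fin.Patterns using (0F; 1F; 2F)
open import Data.Fin.Properties using (_<?_; all?; any?)
open import Data.List using (List; []; _∷_; allFin; cartesianProductWith; filter; length; map)
open import Data.List.Relation.Unary.All as All using (All)
open import Data.Nat using (ℕ; zero; suc)
import Data.Nat as ℕ
open import Data.Nat.ListAction using (sum)
open import Data.Product using (_×_; _,_; map₂; uncurry)
open import Data.Vec using (Vec; []; _∷_; lookup)
open import Function.Bundles using (_⇔_; mk⇔; module Equivalence)
open import Function.Definitions using (Bijective)
open import Relation.Binary.PropositionalEquality using (_≡_; refl; cong; trans)
open import Relation.Nullary.Decidable using (Dec; map′; _×-dec_; _→-dec_)
open import Relation.Unary using (Decidable)

-- Every vector appears exactly once, so filtering `words` and taking lengths or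
-- sums counts or sums over the vectors satisfying the predicate.

words : ∀ n k → List (Vec (Fin n) k)
words n zero    = [] ∷ []
words n (suc k) = cartesianProductWith _∷_ (allFin n) (words n k)

-- One-line notation shifted down by one: entry i of σ is the image of i,
-- with both positions and values numbered from 0 to n - 1.

IsPermutation : ∀ {n} → Vec (Fin n) n → Set
IsPermutation σ = Bijective _≡_ _≡_ (lookup σ)

isPermutation? : ∀ {n} → Decidable (IsPermutation {n})
isPermutation? σ = map′
  (λ (inj , surj) → (λ {i} {j} → inj i j) ,
                    (λ v → map₂ (λ σi≡v j≡i → trans (cong (lookup σ) j≡i) σi≡v) (surj v)))
  (λ (inj , surj) → (λ i j → inj {i} {j}) ,
                    (λ v → map₂ (λ hit → hit refl) (surj v)))
  (all? (λ i → all? λ j → (lookup σ i ≟ lookup σ j) →-dec (i ≟ j))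
   ×-dec
   all? (λ v → any? λ i → lookup σ i ≟ v))

S : ∀ n → List (Vec (Fin n) n)
S n = filter isPermutation? (words n n)

IsOccurrence : ∀ {k n} → Vec (Fin k) k → Vec (Fin n) n → Vec (Fin n) k → Set
IsOccurrence q σ i =
  (∀ j l → j < l → lookup i j < lookup i l) ×
  (∀ j l → lookup q j < lookup q l ⇔ lookup σ (lookup i j) < lookup σ (lookup i l))

isOccurrence? : ∀ {k n} (q : Vec (Fin k) k) (σ : Vec (Fin n) n) → Decidable (IsOccurrence q σ)
isOccurrence? q σ i =
  all? (λ j → all? λ l → (j <? l) →-dec (lookup i j <? lookup i l))
  ×-dec
  all? (λ j → all? λ l →
    (lookup q j <? lookup q l) ⇔-dec (lookup σ (lookup i j) <? lookup σ (lookup i l)))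
  where
  _⇔-dec_ : ∀ {A B : Set} → Dec A → Dec B → Dec (A ⇔ B)
  a? ⇔-dec b? = map′ (uncurry mk⇔)
    (λ e → Equivalence.to e , Equivalence.from e)
    ((a? →-dec b?) ×-dec (b? →-dec a?))

occurrences : ∀ {k n} → Vec (Fin k) k → Vec (Fin n) n → ℕ
occurrences {k} {n} q σ = length (filter (isOccurrence? q σ) (words n k))

Avoids : ∀ {k n} → Vec (Fin n) n → Vec (Fin k) k → Set
Avoids σ q = occurrences q σ ≡ 0

avoids? : ∀ {k n} (σ : Vec (Fin n) n) → Decidable (Avoids {k} σ)
avoids? σ q = occurrences q σ ℕ.≟ 0

AvoidsAll : ∀ {k n} → List (Vec (Fin k) k) → Vec (Fin n) n → Set
AvoidsAll qs σ = All (Avoids σ) qs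

avoidsAll? : ∀ {k n} (qs : List (Vec (Fin k) k)) → Decidable (AvoidsAll {k} {n} qs)
avoidsAll? qs σ = All.all? (avoids? σ) qs

S-avoiding : ∀ {k} n → List (Vec (Fin k) k) → List (Vec (Fin n) n)
S-avoiding n qs = filter (avoidsAll? qs) (S n)

p123 p132 p213 p231 p312 p321 : Vec (Fin 3) 3
p123 = 0F ∷ 1F ∷ 2F ∷ []
p132 = 0F ∷ 2F ∷ 1F ∷ []
p213 = 1F ∷ 0F ∷ 2F ∷ []
p231 = 1F ∷ 2F ∷ 0F ∷ []
p312 = 2F ∷ 0F ∷ 1F ∷ []
p321 = 2F ∷ 1F ∷ 0F ∷ []

f : ∀ {k} → Vec (Fin k) k → ℕ → ℕ
f q n = sum (map (occurrences q) (S-avoiding n (p123 ∷ p231 ∷ p312 ∷ [])))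

{-# OPTIONS --safe #-}

-- A permutation avoiding 123, 231 and 312 is determined by m = σ 0: it is the
-- reflection p ↦ m - p of ℤ/n, decreasing on {0, …, m} and on {m + 1, …, n - 1},
-- so that for p < q one has σ p < σ q exactly when p ≤ m < q.  Hence an
-- occurrence i < j < l of
--   132 satisfies i ≤ m < j < l, i.e. i < m + 1 < j + 1 < l + 1 ≤ n,
--   213 satisfies i < j ≤ m < l, i.e. i < j < m + 1 < l + 1 ≤ n,
--   321 satisfies i < j < l < m + 1 ≤ n or m < i < j < l < n,
-- and each of these conditions describes the 4-subsets of {0, …, n} or, in the
-- last case, of {0, …, n - 1}.

module Submission where

open import Defs
open import Data.Nat using (ℕ; _+_; _*_; _∸_; _^_; _≥_)
open import Data.Nat.Combinatorics using (_C_)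
open import Data.Integer using (+_)
open import Data.Rational using (_/_)
open import Data.Product using (_×_)
open import Relation.Binary.PropositionalEquality using (_≡_)

open import Data.Bool using (true; false; if_then_else_)
open import Data.Fin as Fin using (Fin; toℕ; fromℕ<)
open import Data.Fin.Induction using (<-wellFounded)
open import Data.Fin.Patterns using (0F; 1F; 2F)
open import Data.Fin.Properties as Fin using (toℕ<n; toℕ-injective; toℕ-fromℕ<)
import Data.Integer.Properties as ℤ
open import Data.List using (List; []; _∷_; _++_; cartesianProduct; filter; length; map)
open import Data.List.Membership.Propositional using (_∈_)
open import Data.List.Membership.Propositional.Properties
open import Data.List.Membership.Propositional.Properties.WithK using (unique∧set⇒bag)
open import Data.List.Properties using (length-++; length-map; filter-++; filter-none)
open import Data.List.Relation.Binary.BagAndSetEquality using (∼bag⇒↭)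
open import Data.List.Relation.Binary.Permutation.Propositional.Properties using (↭-length)
open import Data.List.Relation.Unary.All as All using ([]; _∷_)
import Data.List.Relation.Unary.All.Properties as All
open import Data.List.Relation.Unary.Any using (here; there)
open import Data.List.Relation.Unary.AllPairs using ([]; _∷_)
open import Data.List.Relation.Unary.Unique.Propositional using (Unique)
import Data.List.Relation.Unary.Unique.Propositional.Properties as Unique
open import Data.Nat using (zero; suc; _≤_; _<_; _≤?_; z≤n; s≤s; z<s; s≤s⁻¹)
open import Data.Nat.Combinatorics using (nC1≡n; nCk+nC[k+1]≡[n+1]C[k+1])
open import Data.Nat.ListAction using (sum)
open import Data.Nat.Properties
open import Data.Nat.Tactic.RingSolver using (solve-∀)
open import Data.Product using (∃; _,_; proj₁; proj₂)
import Data.Rational.Properties as ℚ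
open import Data.Rational.Unnormalised using (mkℚᵘ; *≡*)
open import Data.Sum using (_⊎_; inj₁; inj₂)
open import Data.Sum.Properties using (inj₁-injective; inj₂-injective)
open import Data.Vec using (Vec; []; _∷_; lookup; tabulate)
open import Data.Vec.Properties using (∷-injective; ∷-injectiveʳ; lookup∘tabulate; tabulate∘lookup; tabulate-cong)
open import Function using (_∘_; mk⇔; Equivalence)
open import Induction.WellFounded using (Acc; acc)
open import Relation.Binary using (tri<; tri≈; tri>)
open import Relation.Binary.PropositionalEquality using (refl; sym; trans; cong; cong₂; subst; subst₂; module ≡-Reasoning)
open import Relation.Nullary using (¬_; does; yes; no; contradiction)
open import Relation.Nullary.Decidable using (dec-true; dec-false)
open import Relation.Unary using (Decidable)

private
  variable
    A B : Set
    m n r : ℕ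

-- Counting by bijections

-- Injectivity is asked only between entries of the list: the encoding used later determines a
-- permutation only among reflections.
map-unique : (g : A → B) {xs : List A} → Unique xs →
  (∀ {x y} → x ∈ xs → y ∈ xs → g x ≡ g y → x ≡ y) → Unique (map g xs)
map-unique g []         inj = []
map-unique g (x∉xs ∷ u) inj =
  All.map⁺ (All.tabulate λ y∈xs gx≡gy → All.lookup x∉xs y∈xs (inj (here refl) (there y∈xs) gx≡gy))
  ∷ map-unique g u (λ x∈ y∈ → inj (there x∈) (there y∈))

-- Two duplicate-free lists with the same entries are equal as bags, hence permutations of each
-- other.
bijection⇒length-≡ : (g : A → B) {xs : List A} {ys : List B} → Unique xs → Unique ys →
  (∀ {x} → x ∈ xs → g x ∈ ys) →
  (∀ {x y} → x ∈ xs → y ∈ xs → g x ≡ g y → x ≡ y) →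
  (∀ {y} → y ∈ ys → ∃ λ x → x ∈ xs × y ≡ g x) →
  length xs ≡ length ys
bijection⇒length-≡ g {xs} {ys} uxs uys into inj onto = trans (sym (length-map g xs))
  (↭-length (∼bag⇒↭ (unique∧set⇒bag (map-unique g uxs inj) uys (mk⇔ to from))))
  where
  to : ∀ {y} → y ∈ map g xs → y ∈ ys
  to y∈ with _ , x∈ , refl ← ∈-map⁻ g y∈ = into x∈
  from : ∀ {y} → y ∈ ys → y ∈ map g xs
  from y∈ with _ , x∈ , refl ← onto y∈ = ∈-map⁺ g x∈

length-filter-map : {P : B → Set} (P? : Decidable P) (g : A → B) (xs : List A) →
  length (filter P? (map g xs)) ≡ length (filter (P? ∘ g) xs)
length-filter-map P? g []       = refl
length-filter-map P? g (x ∷ xs) with does (P? (g x))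
... | true  = cong suc (length-filter-map P? g xs)
... | false = length-filter-map P? g xs

-- Turns the sum of occurrence counts defining `f` into the length of one list of pairs, to which a
-- bijection can be applied.
length-filter-cartesianProduct : {P : A × B → Set} (P? : Decidable P) (xs : List A) (ys : List B) →
  length (filter P? (cartesianProduct xs ys)) ≡ sum (map (λ x → length (filter (λ y → P? (x , y)) ys)) xs)
length-filter-cartesianProduct P? []       ys = refl
length-filter-cartesianProduct P? (x ∷ xs) ys = begin
  length (filter P? (map (x ,_) ys ++ cartesianProduct xs ys))
    ≡⟨ cong length (filter-++ P? (map (x ,_) ys) _) ⟩
  length (filter P? (map (x ,_) ys) ++ filter P? (cartesianProduct xs ys))
    ≡⟨ length-++ (filter P? (map (x ,_) ys)) ⟩
  length (filter P? (map (x ,_) ys)) + length (filter P? (cartesianProduct xs ys))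
    ≡⟨ cong₂ _+_ (length-filter-map P? (x ,_) ys) (length-filter-cartesianProduct P? xs ys) ⟩
  sum (map (λ x → length (filter (λ y → P? (x , y)) ys)) (x ∷ xs)) ∎
  where open ≡-Reasoning

-- Finite subsets and binomial coefficients

-- The r-subsets of {0, …, m - 1}, as strictly decreasing vectors.
descending : (m r : ℕ) → List (Vec ℕ r)
descending m       zero    = [] ∷ []
descending zero    (suc r) = []
descending (suc m) (suc r) = map (m ∷_) (descending m r) ++ descending m (suc r)

-- Splitting the subsets by whether they contain the largest available element is Pascal's rule.
length-descending : (m r : ℕ) → length (descending m r) ≡ m C r
length-descending m       zero    = refl
length-descending zero    (suc r) = refl
length-descending (suc m) (suc r) = begin
  length (map (m ∷_) (descending m r) ++ descending m (suc r))
    ≡⟨ length-++ (map (m ∷_) (descending m r)) ⟩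
  length (map (m ∷_) (descending m r)) + length (descending m (suc r))
    ≡⟨ cong₂ _+_ (trans (length-map _ (descending m r)) (length-descending m r)) (length-descending m (suc r)) ⟩
  m C r + m C suc r
    ≡⟨ nCk+nC[k+1]≡[n+1]C[k+1] m r ⟩
  suc m C suc r ∎
  where open ≡-Reasoning

∈-descending⁻ : ∀ (m : ℕ) {x} {xs : Vec ℕ r} → (x ∷ xs) ∈ descending m (suc r) → x < m × xs ∈ descending x r
∈-descending⁻ {r} (suc m) p with ∈-++⁻ (map (m ∷_) (descending m r)) p
... | inj₁ q with _ , xs∈ , refl ← ∈-map⁻ (m ∷_) q = n<1+n m , xs∈
... | inj₂ q with x<m , xs∈ ← ∈-descending⁻ m q = m<n⇒m<1+n x<m , xs∈

∈-descending⁺ : ∀ {m x} {xs : Vec ℕ r} → x < m → xs ∈ descending x r → (x ∷ xs) ∈ descending m (suc r)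
∈-descending⁺ {r} {suc m} x<1+m xs∈ with m≤n⇒m<n∨m≡n (s≤s⁻¹ x<1+m)
... | inj₁ x<m  = ∈-++⁺ʳ (map (m ∷_) (descending m r)) (∈-descending⁺ x<m xs∈)
... | inj₂ refl = ∈-++⁺ˡ (∈-map⁺ (m ∷_) xs∈)

∈-descending₄⁻ : ∀ {m a b c d} → (d ∷ c ∷ b ∷ a ∷ []) ∈ descending m 4 → a < b × b < c × c < d × d < m
∈-descending₄⁻ v∈
  with d<m , v∈ ← ∈-descending⁻ _ v∈
  with c<d , v∈ ← ∈-descending⁻ _ v∈
  with b<c , v∈ ← ∈-descending⁻ _ v∈
  with a<b , _  ← ∈-descending⁻ _ v∈ = a<b , b<c , c<d , d<m

∈-descending₄⁺ : ∀ {m a b c d} → a < b → b < c → c < d → d < m → (d ∷ c ∷ b ∷ a ∷ []) ∈ descending m 4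
∈-descending₄⁺ a<b b<c c<d d<m =
  ∈-descending⁺ d<m (∈-descending⁺ c<d (∈-descending⁺ b<c (∈-descending⁺ a<b (here refl))))

descending-unique : ∀ m r → Unique (descending m r)
descending-unique m       zero    = [] ∷ []
descending-unique zero    (suc r) = []
descending-unique (suc m) (suc r) =
  Unique.++⁺ (Unique.map⁺ ∷-injectiveʳ (descending-unique m r)) (descending-unique m (suc r)) disjoint
  where
  disjoint : ∀ {v} → ¬ (v ∈ map (m ∷_) (descending m r) × v ∈ descending m (suc r))
  disjoint (p , q) with _ , _ , refl ← ∈-map⁻ (m ∷_) p = <-irrefl refl (proj₁ (∈-descending⁻ m q))

-- Occurrences of patterns of length 3

monotone₃ : (v : Fin 3 → Fin n) → v 0F Fin.< v 1F → v 1F Fin.< v 2F → ∀ a b → a Fin.< b → v a Fin.< v b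
monotone₃ v v₀₁ v₁₂ 0F 1F _ = v₀₁
monotone₃ v v₀₁ v₁₂ 0F 2F _ = <-trans v₀₁ v₁₂
monotone₃ v v₀₁ v₁₂ 1F 2F _ = v₁₂
monotone₃ v v₀₁ v₁₂ 1F 1F (s≤s ())
monotone₃ v v₀₁ v₁₂ 2F 1F (s≤s ())
monotone₃ v v₀₁ v₁₂ 2F 2F (s≤s (s≤s ()))

-- `q⁻¹` lists the positions by increasing letter, so comparing consecutive letters fixes the order
-- of all three values. The converse implication follows by trichotomy, `q` being injective because
-- it has a left inverse.
occurrence₃ : (q q⁻¹ : Vec (Fin 3) 3) → (∀ a → lookup q⁻¹ (lookup q a) ≡ a) →
  (σ : Vec (Fin n) n) {x y z : Fin n} → let i = x ∷ y ∷ z ∷ [] in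
  x Fin.< y → y Fin.< z →
  lookup σ (lookup i (lookup q⁻¹ 0F)) Fin.< lookup σ (lookup i (lookup q⁻¹ 1F)) →
  lookup σ (lookup i (lookup q⁻¹ 1F)) Fin.< lookup σ (lookup i (lookup q⁻¹ 2F)) →
  IsOccurrence q σ i
occurrence₃ {n} q q⁻¹ inverse σ {x} {y} {z} x<y y<z s₀₁ s₁₂ =
  monotone₃ (lookup i) x<y y<z , λ j l → mk⇔ (preserves j l) (reflects j l)
  where
  i : Vec (Fin n) 3
  i = x ∷ y ∷ z ∷ []
  s : Fin 3 → Fin n
  s j = lookup σ (lookup i j)
  preserves : ∀ j l → lookup q j Fin.< lookup q l → s j Fin.< s l
  preserves j l qj<ql = subst₂ Fin._<_ (cong s (inverse j)) (cong s (inverse l))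
    (monotone₃ (s ∘ lookup q⁻¹) s₀₁ s₁₂ _ _ qj<ql)
  reflects : ∀ j l → s j Fin.< s l → lookup q j Fin.< lookup q l
  reflects j l sj<sl with Fin.<-cmp (lookup q j) (lookup q l)
  ... | tri< qj<ql _ _ = qj<ql
  ... | tri> _ _ ql<qj = contradiction (preserves l j ql<qj) (<-asym sj<sl)
  ... | tri≈ _ qj≡ql _ = contradiction sj<sl
    (<-irrefl (cong (toℕ ∘ s) (trans (sym (inverse j)) (trans (cong (lookup q⁻¹) qj≡ql) (inverse l)))))

occurrence123 : (σ : Vec (Fin n) n) {i j l : Fin n} → i Fin.< j → j Fin.< l →
  lookup σ i Fin.< lookup σ j → lookup σ j Fin.< lookup σ l → IsOccurrence p123 σ (i ∷ j ∷ l ∷ [])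
occurrence123 = occurrence₃ p123 p123 (λ { 0F → refl ; 1F → refl ; 2F → refl })

occurrence132 : (σ : Vec (Fin n) n) {i j l : Fin n} → i Fin.< j → j Fin.< l →
  lookup σ i Fin.< lookup σ l → lookup σ l Fin.< lookup σ j → IsOccurrence p132 σ (i ∷ j ∷ l ∷ [])
occurrence132 = occurrence₃ p132 p132 (λ { 0F → refl ; 1F → refl ; 2F → refl })

occurrence213 : (σ : Vec (Fin n) n) {i j l : Fin n} → i Fin.< j → j Fin.< l →
  lookup σ j Fin.< lookup σ i → lookup σ i Fin.< lookup σ l → IsOccurrence p213 σ (i ∷ j ∷ l ∷ [])
occurrence213 = occurrence₃ p213 p213 (λ { 0F → refl ; 1F → refl ; 2F → refl })

-- As permutations 231 and 312 are inverse to each other, while the other four patterns are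
-- involutions.
occurrence231 : (σ : Vec (Fin n) n) {i j l : Fin n} → i Fin.< j → j Fin.< l →
  lookup σ l Fin.< lookup σ i → lookup σ i Fin.< lookup σ j → IsOccurrence p231 σ (i ∷ j ∷ l ∷ [])
occurrence231 = occurrence₃ p231 p312 (λ { 0F → refl ; 1F → refl ; 2F → refl })

occurrence312 : (σ : Vec (Fin n) n) {i j l : Fin n} → i Fin.< j → j Fin.< l →
  lookup σ j Fin.< lookup σ l → lookup σ l Fin.< lookup σ i → IsOccurrence p312 σ (i ∷ j ∷ l ∷ [])
occurrence312 = occurrence₃ p312 p231 (λ { 0F → refl ; 1F → refl ; 2F → refl })

occurrence321 : (σ : Vec (Fin n) n) {i j l : Fin n} → i Fin.< j → j Fin.< l →
  lookup σ l Fin.< lookup σ j → lookup σ j Fin.< lookup σ i → IsOccurrence p321 σ (i ∷ j ∷ l ∷ [])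
occurrence321 = occurrence₃ p321 p321 (λ { 0F → refl ; 1F → refl ; 2F → refl })

occurrence⇒< : (q : Vec (Fin r) r) (σ : Vec (Fin n) n) (i : Vec (Fin n) r) → IsOccurrence q σ i →
  ∀ j l → lookup q j Fin.< lookup q l → lookup σ (lookup i j) Fin.< lookup σ (lookup i l)
occurrence⇒< q σ i (_ , order) j l = Equivalence.to (order j l)

∈-words : ∀ {n k} (v : Vec (Fin n) k) → v ∈ words n k
∈-words []      = here refl
∈-words (x ∷ v) = ∈-cartesianProductWith⁺ _∷_ (∈-allFin x) (∈-words v)

words-unique : ∀ n k → Unique (words n k)
words-unique n zero    = [] ∷ []
words-unique n (suc k) =
  Unique.cartesianProductWith⁺ _∷_ ∷-injective (Unique.allFin⁺ n) (words-unique n k)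

avoids⇒¬occurrence : (q : Vec (Fin r) r) (σ : Vec (Fin n) n) → Avoids σ q → ∀ i → ¬ IsOccurrence q σ i
avoids⇒¬occurrence q σ avoids i occ =
  <-irrefl (sym avoids) (∈-length (∈-filter⁺ (isOccurrence? q σ) (∈-words i) occ))

¬occurrence⇒avoids : (q : Vec (Fin r) r) (σ : Vec (Fin n) n) → (∀ i → ¬ IsOccurrence q σ i) → Avoids σ q
¬occurrence⇒avoids q σ none =
  cong length (filter-none (isOccurrence? q σ) {words _ _} (All.tabulate λ {i} _ → none i))

-- Reflections of ℤ/n

-- v = m - p in ℤ/n.
data Reflects {n} (m p v : Fin n) : Set where
  exact   : toℕ p + toℕ v ≡ toℕ m     → Reflects m p v
  wrapped : toℕ p + toℕ v ≡ n + toℕ m → Reflects m p v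

-- Reflecting is an involution, so positions and values may trade places.
reflects-sym : {m p v : Fin n} → Reflects m p v → Reflects m v p
reflects-sym {p = p} {v} (exact e)   = exact (trans (+-comm (toℕ v) (toℕ p)) e)
reflects-sym {p = p} {v} (wrapped e) = wrapped (trans (+-comm (toℕ v) (toℕ p)) e)

summand-≤ : ∀ p {v m} → p + v ≡ m → p ≤ m
summand-≤ p e = ≤-trans (m≤m+n p _) (≤-reflexive e)

wrapped-< : ∀ {p v m} → v < n → p + v ≡ n + m → m < p
wrapped-< {n} {p} {v} {m} v<n e = +-cancelˡ-< n m p (begin-strict
  n + m ≡⟨ e ⟨
  p + v <⟨ +-monoʳ-< p v<n ⟩
  p + n ≡⟨ +-comm p n ⟩
  n + p ∎)
  where open ≤-Reasoning

-- This is why a reflection decreases on each block: there position plus value is constant.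
equal-sum-< : ∀ {p v q w} → p + v ≡ q + w → p < q → w < v
equal-sum-< e p<q = ≰⇒> λ v≤w → <-irrefl e (+-mono-<-≤ p<q v≤w)

-- A reflection maps each of the blocks {0, ..., m} and {m + 1, ..., n - 1} to itself; matching on
-- `Layer` yields the block of position and value together with the equation.
data Layer {n} (m p v : Fin n) : Set where
  lower : p Fin.≤ m → v Fin.≤ m → toℕ p + toℕ v ≡ toℕ m     → Layer m p v
  upper : m Fin.< p → m Fin.< v → toℕ p + toℕ v ≡ n + toℕ m → Layer m p v

layer : {m p v : Fin n} → Reflects m p v → Layer m p v
layer {p = p} {v} (exact e) =
  lower (summand-≤ (toℕ p) e) (summand-≤ (toℕ v) (trans (+-comm (toℕ v) (toℕ p)) e)) e
layer {p = p} {v} (wrapped e) =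
  upper (wrapped-< (toℕ<n v) e) (wrapped-< (toℕ<n p) (trans (+-comm (toℕ v) (toℕ p)) e)) e

module _ {m p q v w : Fin n} (p↦v : Reflects m p v) (q↦w : Reflects m q w) (p<q : p Fin.< q) where

  ascent⁺ : p Fin.≤ m → m Fin.< q → v Fin.< w
  ascent⁺ p≤m m<q with layer p↦v | layer q↦w
  ... | lower _ v≤m _ | upper _ m<w _ = ≤-<-trans v≤m m<w
  ... | lower _ _ _   | lower q≤m _ _ = contradiction m<q (≤⇒≯ q≤m)
  ... | upper m<p _ _ | _             = contradiction m<p (≤⇒≯ p≤m)

  -- Inside a block values decrease, so an ascent has to cross from the lower block to the upper
  -- one.
  ascent⁻ : v Fin.< w → p Fin.≤ m × m Fin.< q
  ascent⁻ v<w with layer p↦v | layer q↦w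
  ... | lower p≤m _ _ | upper m<q _ _ = p≤m , m<q
  ... | lower _ _ e   | lower _ _ e′  = contradiction (equal-sum-< (trans e (sym e′)) p<q) (<-asym v<w)
  ... | upper _ _ e   | upper _ _ e′  = contradiction (equal-sum-< (trans e (sym e′)) p<q) (<-asym v<w)
  ... | upper m<p _ _ | lower q≤m _ _ = contradiction (<-trans m<p p<q) (≤⇒≯ q≤m)

  -- As p < q, the disjunction says that both positions share a block, lower or upper respectively.
  descent⁺ : q Fin.≤ m ⊎ m Fin.< p → w Fin.< v
  descent⁺ side with layer p↦v | layer q↦w | side
  ... | lower _ _ e   | lower _ _ e′  | _        = equal-sum-< (trans e (sym e′)) p<q
  ... | upper _ _ e   | upper _ _ e′  | _        = equal-sum-< (trans e (sym e′)) p<q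
  ... | lower p≤m _ _ | upper _ _ _   | inj₂ m<p = contradiction m<p (≤⇒≯ p≤m)
  ... | lower _ _ _   | upper m<q _ _ | inj₁ q≤m = contradiction m<q (≤⇒≯ q≤m)
  ... | upper m<p _ _ | lower q≤m _ _ | _        = contradiction (<-trans m<p p<q) (≤⇒≯ q≤m)

  descent⁻ : w Fin.< v → q Fin.≤ m ⊎ m Fin.< p
  descent⁻ w<v with layer p↦v | layer q↦w
  ... | upper m<p _ _ | _             = inj₂ m<p
  ... | lower _ _ _   | lower q≤m _ _ = inj₁ q≤m
  ... | lower _ v≤m _ | upper _ m<w _ = contradiction (<-trans w<v (≤-<-trans v≤m m<w)) (<-irrefl refl)

-- Whether p ≤ m decides which of the two equations holds for both values, and then p cancels.
reflects-functional : {m p v w : Fin n} → Reflects m p v → Reflects m p w → v ≡ w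
reflects-functional {p = p} p↦v p↦w with layer p↦v | layer p↦w
... | lower _ _ e   | lower _ _ e′  = toℕ-injective (+-cancelˡ-≡ (toℕ p) _ _ (trans e (sym e′)))
... | upper _ _ e   | upper _ _ e′  = toℕ-injective (+-cancelˡ-≡ (toℕ p) _ _ (trans e (sym e′)))
... | lower p≤m _ _ | upper m<p _ _ = contradiction m<p (≤⇒≯ p≤m)
... | upper m<p _ _ | lower p≤m _ _ = contradiction m<p (≤⇒≯ p≤m)

reflects-total : (m p : Fin n) → ∃ (Reflects m p)
reflects-total {n} m p with toℕ p ≤? toℕ m
... | yes p≤m = fromℕ< m∸p<n , exact (trans (cong (λ v → toℕ p + v) (toℕ-fromℕ< m∸p<n)) (m+[n∸m]≡n p≤m))
  where
  m∸p<n : toℕ m ∸ toℕ p < n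
  m∸p<n = ≤-<-trans (m∸n≤m (toℕ m) (toℕ p)) (toℕ<n m)
... | no p≰m = fromℕ< n+m∸p<n , wrapped (trans (cong (λ v → toℕ p + v) (toℕ-fromℕ< n+m∸p<n)) p+[n+m∸p]≡n+m)
  where
  p+[n+m∸p]≡n+m : toℕ p + (n + toℕ m ∸ toℕ p) ≡ n + toℕ m
  p+[n+m∸p]≡n+m = m+[n∸m]≡n (≤-trans (<⇒≤ (toℕ<n p)) (m≤m+n n (toℕ m)))
  n+m∸p<n : n + toℕ m ∸ toℕ p < n
  -- The sums m + n and p + (n + m - p) agree, so m < p makes the second summand of the latter
  -- smaller than n.
  n+m∸p<n = equal-sum-< (trans (+-comm (toℕ m) n) (sym p+[n+m∸p]≡n+m)) (≰⇒> p≰m)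

reflection : Fin n → Vec (Fin n) n
reflection m = tabulate (proj₁ ∘ reflects-total m)

reflection-reflects : (m p : Fin n) → Reflects m p (lookup (reflection m) p)
reflection-reflects m p =
  subst (Reflects m p) (sym (lookup∘tabulate (proj₁ ∘ reflects-total m) p)) (proj₂ (reflects-total m p))

lookup-reflection-0 : (m : Fin (suc n)) → lookup (reflection m) 0F ≡ m
lookup-reflection-0 m = reflects-functional (reflection-reflects m 0F) (exact refl)

-- The length `suc n` provides a position 0, where the centre m is read off because m - 0 = m.
IsReflection : Vec (Fin (suc n)) (suc n) → Set
IsReflection σ = ∀ p → Reflects (lookup σ 0F) p (lookup σ p)

reflection-isReflection : (m : Fin (suc n)) → IsReflection (reflection m)
reflection-isReflection m p =
  subst (λ m′ → Reflects m′ p (lookup (reflection m) p)) (sym (lookup-reflection-0 m)) (reflection-reflects m p)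

isReflection-unique : {σ τ : Vec (Fin (suc n)) (suc n)} → IsReflection σ → IsReflection τ →
  lookup σ 0F ≡ lookup τ 0F → σ ≡ τ
isReflection-unique {σ = σ} {τ} σ-refl τ-refl σ₀≡τ₀ = begin
  σ                   ≡⟨ tabulate∘lookup σ ⟨
  tabulate (lookup σ) ≡⟨ tabulate-cong (λ p → reflects-functional (σ-refl p) (τ-refl′ p)) ⟩
  tabulate (lookup τ) ≡⟨ tabulate∘lookup τ ⟩
  τ                   ∎
  where
  open ≡-Reasoning
  τ-refl′ : ∀ p → Reflects (lookup σ 0F) p (lookup τ p)
  τ-refl′ p = subst (λ m → Reflects m p (lookup τ p)) (sym σ₀≡τ₀) (τ-refl p)

-- An involution is bijective: a value is reflected back to find its position.
isReflection⇒isPermutation : {σ : Vec (Fin (suc n)) (suc n)} → IsReflection σ → IsPermutation σ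
isReflection⇒isPermutation {σ = σ} σ-refl = injective , surjective
  where
  injective : ∀ {p q} → lookup σ p ≡ lookup σ q → p ≡ q
  injective {p} {q} σp≡σq = reflects-functional (reflects-sym (σ-refl p))
    (subst (λ v → Reflects (lookup σ 0F) v q) (sym σp≡σq) (reflects-sym (σ-refl q)))
  surjective : ∀ v → ∃ λ p → ∀ {q} → q ≡ p → lookup σ q ≡ v
  surjective v with p , v↦p ← reflects-total (lookup σ 0F) v =
    p , λ where refl → reflects-functional (σ-refl p) (reflects-sym v↦p)

-- Reflections are exactly the avoiding permutations

pattern 0<1 = s≤s z≤n
pattern 0<2 = s≤s z≤n
pattern 1<2 = s≤s (s≤s z≤n)

-- The two ascents of 123 would put the middle position in both blocks. In 231 and 312 the adjacent
-- ascent separates the two end positions by m, so they form an ascent where the pattern demands a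
-- descent.
isReflection⇒avoids : (σ : Vec (Fin (suc n)) (suc n)) → IsReflection σ →
  AvoidsAll (p123 ∷ p231 ∷ p312 ∷ []) σ
isReflection⇒avoids σ σ-refl =
  ¬occurrence⇒avoids p123 σ avoids123 ∷
  ¬occurrence⇒avoids p231 σ avoids231 ∷
  ¬occurrence⇒avoids p312 σ avoids312 ∷ []
  where
  avoids123 : ∀ i → ¬ IsOccurrence p123 σ i
  avoids123 is@(i ∷ j ∷ l ∷ []) occ@(incr , _)
    -- The inequality given to `incr` compares positions of the pattern, the one given to
    -- `occurrence⇒<` compares its letters.
    with _ , m<j ← ascent⁻ (σ-refl i) (σ-refl j) (incr 0F 1F 0<1) (occurrence⇒< p123 σ is occ 0F 1F 0<1)
       | j≤m , _ ← ascent⁻ (σ-refl j) (σ-refl l) (incr 1F 2F 1<2) (occurrence⇒< p123 σ is occ 1F 2F 1<2)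
    = ≤⇒≯ j≤m m<j
  avoids231 : ∀ i → ¬ IsOccurrence p231 σ i
  avoids231 is@(i ∷ j ∷ l ∷ []) occ@(incr , _)
    with i≤m , m<j ← ascent⁻ (σ-refl i) (σ-refl j) (incr 0F 1F 0<1) (occurrence⇒< p231 σ is occ 0F 1F 1<2)
    = <-asym (ascent⁺ (σ-refl i) (σ-refl l) (incr 0F 2F 0<2) i≤m (<-trans m<j (incr 1F 2F 1<2)))
             (occurrence⇒< p231 σ is occ 2F 0F 0<1)
  avoids312 : ∀ i → ¬ IsOccurrence p312 σ i
  avoids312 is@(i ∷ j ∷ l ∷ []) occ@(incr , _)
    with j≤m , m<l ← ascent⁻ (σ-refl j) (σ-refl l) (incr 1F 2F 1<2) (occurrence⇒< p312 σ is occ 1F 2F 0<1)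
    = <-asym (ascent⁺ (σ-refl i) (σ-refl l) (incr 0F 2F 0<2) (≤-trans (<⇒≤ (incr 0F 1F 0<1)) j≤m) m<l)
             (occurrence⇒< p312 σ is occ 2F 0F 1<2)

-- Strong induction on p: if σ p differed from the reflected value v of p, then v
-- would sit at a later position r and the reflected position p′ of σ p would
-- exceed p, and the entries at 0, p, r would form a forbidden pattern.
isReflection-criterion : (σ : Vec (Fin (suc n)) (suc n)) → IsPermutation σ →
  (∀ {p r} → 0 < toℕ p → p Fin.< r → lookup σ 0F Fin.< lookup σ p → ¬ lookup σ p Fin.< lookup σ r) →
  (∀ {p r} → 0 < toℕ p → p Fin.< r → lookup σ r Fin.< lookup σ 0F → ¬ lookup σ 0F Fin.< lookup σ p) →
  (∀ {p r} → 0 < toℕ p → p Fin.< r → lookup σ p Fin.< lookup σ r → ¬ lookup σ r Fin.< lookup σ 0F) →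
  IsReflection σ
isReflection-criterion {n} σ (injective , surjective) no123 no231 no312 p = go p (<-wellFounded p)
  where
  σ₀ : Fin (suc n)
  σ₀ = lookup σ 0F
  go : ∀ p → Acc Fin._<_ p → Reflects σ₀ p (lookup σ p)
  go 0F            _         = exact refl
  go p@(Fin.suc _) (acc rec) with reflects-total σ₀ p | reflects-total σ₀ (lookup σ p)
  ... | v , p↦v | p′ , σp↦p′ with surjective v
  ... | r , σr with refl ← σr refl with Fin.<-cmp r p | Fin.<-cmp p′ p
  -- If r or p′ lies before p, the induction hypothesis there forces it to equal p: for r since both
  -- reflect to v, for p′ since σ takes the same value at p′ and p.
  ... | tri< r<p r≢p _ | _ =
    contradiction (reflects-functional (reflects-sym (go r (rec r<p))) (reflects-sym p↦v)) r≢p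
  ... | tri≈ _ refl _  | _ = p↦v
  ... | tri> _ _ _     | tri≈ _ refl _  = reflects-sym σp↦p′
  ... | tri> _ _ _     | tri< p′<p p′≢p _ =
    contradiction (injective (reflects-functional (go p′ (rec p′<p)) (reflects-sym σp↦p′))) p′≢p
  -- Now r and p′ both exceed p. With m = σ 0, the positions 0, p, r form 312 if v and σ p are both
  -- at most m, 231 if only v is, and 123 if neither is; σ p alone being at most m would give p′ ≤ m
  -- < p. The sum 0 + m = p + v yields v < m, as p is positive.
  ... | tri> _ _ p<r   | tri> _ _ p<p′ with layer p↦v | layer (reflects-sym σp↦p′)
  ... | lower _ _ e   | lower _ _ e′   =
    contradiction (equal-sum-< {0} (sym e) z<s) (no312 z<s p<r (equal-sum-< (trans e (sym e′)) p<p′))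
  ... | lower _ _ e   | upper _ m<w _  = contradiction m<w (no231 z<s p<r (equal-sum-< {0} (sym e) z<s))
  ... | upper m<p _ _ | lower p′≤m _ _ = contradiction (<-trans m<p p<p′) (≤⇒≯ p′≤m)
  ... | upper _ _ e   | upper _ m<w e′ = contradiction (equal-sum-< (trans e (sym e′)) p<p′) (no123 z<s p<r m<w)

avoids⇒isReflection : (σ : Vec (Fin (suc n)) (suc n)) → IsPermutation σ →
  AvoidsAll (p123 ∷ p231 ∷ p312 ∷ []) σ → IsReflection σ
avoids⇒isReflection σ perm (av123 ∷ av231 ∷ av312 ∷ []) = isReflection-criterion σ perm
  (λ {p} {r} 0<p p<r a b → avoids⇒¬occurrence p123 σ av123 (0F ∷ p ∷ r ∷ []) (occurrence123 σ 0<p p<r a b))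
  (λ {p} {r} 0<p p<r a b → avoids⇒¬occurrence p231 σ av231 (0F ∷ p ∷ r ∷ []) (occurrence231 σ 0<p p<r a b))
  (λ {p} {r} 0<p p<r a b → avoids⇒¬occurrence p312 σ av312 (0F ∷ p ∷ r ∷ []) (occurrence312 σ 0<p p<r a b))

-- The bijections with 4-subsets

∈-S-avoiding⁻ : (qs : List (Vec (Fin r) r)) {σ : Vec (Fin n) n} → σ ∈ S-avoiding n qs →
  IsPermutation σ × AvoidsAll qs σ
∈-S-avoiding⁻ {n = n} qs σ∈ =
  let σ∈S , avoids = ∈-filter⁻ (avoidsAll? qs) {xs = S n} σ∈
  in proj₂ (∈-filter⁻ isPermutation? {xs = words n n} σ∈S) , avoids

∈-S-avoiding⁺ : (qs : List (Vec (Fin r) r)) {σ : Vec (Fin n) n} → IsPermutation σ → AvoidsAll qs σ →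
  σ ∈ S-avoiding n qs
∈-S-avoiding⁺ qs {σ} perm avoids =
  ∈-filter⁺ (avoidsAll? qs) (∈-filter⁺ isPermutation? (∈-words σ) perm) avoids

abstract

  occurrencePairs : Vec (Fin 3) 3 → (n : ℕ) → List (Vec (Fin n) n × Vec (Fin n) 3)
  occurrencePairs q n = filter (λ (σ , i) → isOccurrence? q σ i)
    (cartesianProduct (S-avoiding n (p123 ∷ p231 ∷ p312 ∷ [])) (words n 3))

  length-occurrencePairs : ∀ q n → f q n ≡ length (occurrencePairs q n)
  length-occurrencePairs q n = sym (length-filter-cartesianProduct _ (S-avoiding n _) (words n 3))

  occurrencePairs-unique : ∀ q n → Unique (occurrencePairs q n)
  occurrencePairs-unique q n = Unique.filter⁺ _ (Unique.cartesianProduct⁺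
    (Unique.filter⁺ (avoidsAll? _) (Unique.filter⁺ isPermutation? (words-unique n n))) (words-unique n 3))

  -- Here avoidance is traded for being a reflection, the only form in which it enters the counts
  -- below.
  ∈-occurrencePairs⁻ : ∀ q {σ : Vec (Fin (suc n)) (suc n)} {i} → (σ , i) ∈ occurrencePairs q (suc n) →
    IsReflection σ × IsOccurrence q σ i
  ∈-occurrencePairs⁻ {n} q {σ} {i} p∈ =
    let σi∈ , occ     = ∈-filter⁻ (λ (σ , i) → isOccurrence? q σ i)
                          {xs = cartesianProduct (S-avoiding (suc n) (p123 ∷ p231 ∷ p312 ∷ [])) (words (suc n) 3)} p∈
        perm , avoids = ∈-S-avoiding⁻ (p123 ∷ p231 ∷ p312 ∷ [])
                          (proj₁ (∈-cartesianProduct⁻ (S-avoiding (suc n) _) (words (suc n) 3) σi∈))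
    in avoids⇒isReflection σ perm avoids , occ

  ∈-occurrencePairs⁺ : ∀ q {σ : Vec (Fin (suc n)) (suc n)} {i} → IsReflection σ → IsOccurrence q σ i →
    (σ , i) ∈ occurrencePairs q (suc n)
  ∈-occurrencePairs⁺ q {σ} {i} σ-refl occ = ∈-filter⁺ (λ (σ , i) → isOccurrence? q σ i) (∈-cartesianProduct⁺
    (∈-S-avoiding⁺ (p123 ∷ p231 ∷ p312 ∷ []) {σ} (isReflection⇒isPermutation {σ = σ} σ-refl) (isReflection⇒avoids σ σ-refl))
    (∈-words i)) occ

-- A pair (σ , i) is encoded through σ 0 and i, since σ is determined by σ 0.
f≡length : ∀ q (g : Vec (Fin (suc n)) 4 → B) (ys : List B) → Unique ys →
  (∀ {u v} → g u ≡ g v → u ≡ v) →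
  (∀ σ i → IsReflection σ → IsOccurrence q σ i → g (lookup σ 0F ∷ i) ∈ ys) →
  (∀ {y} → y ∈ ys → ∃ λ m → ∃ λ i → IsOccurrence q (reflection m) i × y ≡ g (m ∷ i)) →
  f q (suc n) ≡ length ys
f≡length {n} {B} q g ys ys-unique g-injective g-into g-onto = trans (length-occurrencePairs q (suc n))
  (bijection⇒length-≡ code (occurrencePairs-unique q (suc n)) ys-unique into inj onto)
  where
  code : Vec (Fin (suc n)) (suc n) × Vec (Fin (suc n)) 3 → B
  code (σ , i) = g (lookup σ 0F ∷ i)
  into : ∀ {x} → x ∈ occurrencePairs q (suc n) → code x ∈ ys
  into {σ , i} x∈ = let σ-refl , occ = ∈-occurrencePairs⁻ q {σ} {i} x∈ in g-into σ i σ-refl occ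
  inj : ∀ {x y} → x ∈ occurrencePairs q (suc n) → y ∈ occurrencePairs q (suc n) → code x ≡ code y → x ≡ y
  inj {σ , i} {τ , j} x∈ y∈ eq =
    let m≡ , i≡ = ∷-injective (g-injective eq)
        σ-refl , _ = ∈-occurrencePairs⁻ q {σ} {i} x∈
        τ-refl , _ = ∈-occurrencePairs⁻ q {τ} {j} y∈
    in cong₂ _,_ (isReflection-unique {σ = σ} {τ} σ-refl τ-refl m≡) i≡
  onto : ∀ {y} → y ∈ ys → ∃ λ x → x ∈ occurrencePairs q (suc n) × y ≡ code x
  onto y∈ with m , i , occ , refl ← g-onto y∈ =
    (reflection m , i) , ∈-occurrencePairs⁺ q {reflection m} {i} (reflection-isReflection m) occ ,
    cong (λ m′ → g (m′ ∷ i)) (sym (lookup-reflection-0 m))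

∷-injective₄ : {a b c d a′ b′ c′ d′ : A} → _≡_ {A = Vec A 4} (a ∷ b ∷ c ∷ d ∷ []) (a′ ∷ b′ ∷ c′ ∷ d′ ∷ []) →
  a ≡ a′ × b ≡ b′ × c ≡ c′ × d ≡ d′
∷-injective₄ refl = refl , refl , refl , refl

∷-cong₄-toℕ : {a b c d a′ b′ c′ d′ : Fin n} →
  toℕ a ≡ toℕ a′ → toℕ b ≡ toℕ b′ → toℕ c ≡ toℕ c′ → toℕ d ≡ toℕ d′ →
  _≡_ {A = Vec (Fin n) 4} (a ∷ b ∷ c ∷ d ∷ []) (a′ ∷ b′ ∷ c′ ∷ d′ ∷ [])
∷-cong₄-toℕ a≡ b≡ c≡ d≡
  with refl ← toℕ-injective a≡ | refl ← toℕ-injective b≡ | refl ← toℕ-injective c≡ | refl ← toℕ-injective d≡ = refl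

fromℕ<′ : ∀ {x} → x < n → ∃ λ (i : Fin n) → toℕ i ≡ x
fromℕ<′ x<n = fromℕ< x<n , toℕ-fromℕ< x<n

-- The length being `suc n`, the shift that makes i ≤ m strict sends l to at most n + 1, hence
-- subsets of {0, ..., n + 1}.
f132 : ∀ n → f p132 (suc n) ≡ suc (suc n) C 4
f132 n = trans
  (f≡length p132 g (descending (2 + n) 4) (descending-unique (2 + n) 4) g-injective into onto)
  (length-descending (2 + n) 4)
  where
  g : Vec (Fin (suc n)) 4 → Vec ℕ 4
  g (m ∷ i ∷ j ∷ l ∷ []) = suc (toℕ l) ∷ suc (toℕ j) ∷ suc (toℕ m) ∷ toℕ i ∷ []
  g-injective : ∀ {u v} → g u ≡ g v → u ≡ v
  g-injective {_ ∷ _ ∷ _ ∷ _ ∷ []} {_ ∷ _ ∷ _ ∷ _ ∷ []} eq with l≡ , j≡ , m≡ , i≡ ← ∷-injective₄ eq =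
    ∷-cong₄-toℕ (suc-injective m≡) i≡ (suc-injective j≡) (suc-injective l≡)
  into : ∀ σ i → IsReflection σ → IsOccurrence p132 σ i →
    g (lookup σ 0F ∷ i) ∈ descending (2 + n) 4
  into σ is@(i ∷ j ∷ l ∷ []) σ-refl occ@(incr , _)
    -- The ascent of the first two letters already separates i from j by m, and l comes after j.
    with i≤m , m<j ← ascent⁻ (σ-refl i) (σ-refl j) (incr 0F 1F 0<1) (occurrence⇒< p132 σ is occ 0F 1F 0<2)
    = ∈-descending₄⁺ (s≤s i≤m) (s≤s m<j) (s≤s (incr 1F 2F 1<2)) (s≤s (toℕ<n l))
  onto : ∀ {y} → y ∈ descending (2 + n) 4 → ∃ λ m → ∃ λ i → IsOccurrence p132 (reflection m) i × y ≡ g (m ∷ i)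
  onto {_ ∷ _ ∷ _ ∷ _ ∷ []} y∈
    with s≤s i≤m , s≤s m<j , s≤s j<l , s≤s l<n ← ∈-descending₄⁻ {2 + n} y∈
    -- The entries are bare natural numbers; each is bounded by the next larger one, so positions
    -- are recovered from the top down.
    with l , refl ← fromℕ<′ l<n
    with j , refl ← fromℕ<′ (<-trans j<l l<n)
    with m , refl ← fromℕ<′ (<-trans m<j (toℕ<n j))
    with i , refl ← fromℕ<′ (≤-<-trans i≤m (toℕ<n m))
    = m , (i ∷ j ∷ l ∷ []) , occurrence132 (reflection m) i<j j<l
        (ascent⁺ (reflection-reflects m i) (reflection-reflects m l) (<-trans i<j j<l) i≤m (<-trans m<j j<l))
        (descent⁺ (reflection-reflects m j) (reflection-reflects m l) j<l (inj₂ m<j)) , refl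
    where
    i<j = ≤-<-trans i≤m m<j

-- Now j ≤ m is the weak inequality, so only m and l are shifted.
f213 : ∀ n → f p213 (suc n) ≡ suc (suc n) C 4
f213 n = trans
  (f≡length p213 g (descending (2 + n) 4) (descending-unique (2 + n) 4) g-injective into onto)
  (length-descending (2 + n) 4)
  where
  g : Vec (Fin (suc n)) 4 → Vec ℕ 4
  g (m ∷ i ∷ j ∷ l ∷ []) = suc (toℕ l) ∷ suc (toℕ m) ∷ toℕ j ∷ toℕ i ∷ []
  g-injective : ∀ {u v} → g u ≡ g v → u ≡ v
  g-injective {_ ∷ _ ∷ _ ∷ _ ∷ []} {_ ∷ _ ∷ _ ∷ _ ∷ []} eq with l≡ , m≡ , j≡ , i≡ ← ∷-injective₄ eq =
    ∷-cong₄-toℕ (suc-injective m≡) i≡ j≡ (suc-injective l≡)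
  into : ∀ σ i → IsReflection σ → IsOccurrence p213 σ i →
    g (lookup σ 0F ∷ i) ∈ descending (2 + n) 4
  into σ is@(i ∷ j ∷ l ∷ []) σ-refl occ@(incr , _)
    with j≤m , m<l ← ascent⁻ (σ-refl j) (σ-refl l) (incr 1F 2F 1<2) (occurrence⇒< p213 σ is occ 1F 2F 0<2)
    = ∈-descending₄⁺ (incr 0F 1F 0<1) (s≤s j≤m) (s≤s m<l) (s≤s (toℕ<n l))
  onto : ∀ {y} → y ∈ descending (2 + n) 4 → ∃ λ m → ∃ λ i → IsOccurrence p213 (reflection m) i × y ≡ g (m ∷ i)
  onto {_ ∷ _ ∷ _ ∷ _ ∷ []} y∈
    with i<j , s≤s j≤m , s≤s m<l , s≤s l<n ← ∈-descending₄⁻ {2 + n} y∈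
    with l , refl ← fromℕ<′ l<n
    with m , refl ← fromℕ<′ (<-trans m<l l<n)
    with j , refl ← fromℕ<′ (≤-<-trans j≤m (toℕ<n m))
    with i , refl ← fromℕ<′ (<-trans i<j (toℕ<n j))
    = m , (i ∷ j ∷ l ∷ []) , occurrence213 (reflection m) i<j (≤-<-trans j≤m m<l)
        (descent⁺ (reflection-reflects m i) (reflection-reflects m j) i<j (inj₁ j≤m))
        (ascent⁺ (reflection-reflects m i) (reflection-reflects m l)
          (<-trans i<j (≤-<-trans j≤m m<l)) (≤-trans (<⇒≤ i<j) j≤m) m<l) , refl

-- The three positions share a block. In the lower one l ≤ m needs the shift; in the upper one m < i
-- < j < l is already strict and stays below n + 1.
f321 : ∀ n → f p321 (suc n) ≡ suc (suc n) C 4 + suc n C 4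
f321 n = trans (f≡length p321 g ys ys-unique g-injective into onto) length-ys
  where
  low high : Vec (Fin (suc n)) 4 → Vec ℕ 4
  low  (m ∷ i ∷ j ∷ l ∷ []) = suc (toℕ m) ∷ toℕ l ∷ toℕ j ∷ toℕ i ∷ []
  high (m ∷ i ∷ j ∷ l ∷ []) = toℕ l ∷ toℕ j ∷ toℕ i ∷ toℕ m ∷ []
  g : Vec (Fin (suc n)) 4 → Vec ℕ 4 ⊎ Vec ℕ 4
  -- For an occurrence, l ≤ m means the lower block and its failure means m < i; the tag keeps the
  -- two kinds of subsets apart.
  g v@(m ∷ i ∷ j ∷ l ∷ []) = if does (toℕ l ≤? toℕ m) then inj₁ (low v) else inj₂ (high v)
  ys : List (Vec ℕ 4 ⊎ Vec ℕ 4)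
  ys = map inj₁ (descending (2 + n) 4) ++ map inj₂ (descending (1 + n) 4)
  length-ys : length ys ≡ (2 + n) C 4 + (1 + n) C 4
  length-ys = trans (length-++ (map inj₁ (descending (2 + n) 4))) (cong₂ _+_
    (trans (length-map inj₁ (descending (2 + n) 4)) (length-descending (2 + n) 4))
    (trans (length-map inj₂ (descending (1 + n) 4)) (length-descending (1 + n) 4)))
  ys-unique : Unique ys
  ys-unique = Unique.++⁺
    (Unique.map⁺ inj₁-injective (descending-unique (2 + n) 4))
    (Unique.map⁺ inj₂-injective (descending-unique (1 + n) 4))
    disjoint
    where
    disjoint : ∀ {y} → ¬ (y ∈ map inj₁ (descending (2 + n) 4) × y ∈ map inj₂ (descending (1 + n) 4))
    disjoint (p , q) with ∈-map⁻ inj₁ p | ∈-map⁻ inj₂ q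
    ... | _ , _ , refl | _ , _ , ()
  g-injective : ∀ {u v} → g u ≡ g v → u ≡ v
  g-injective {m ∷ _ ∷ _ ∷ l ∷ []} {m′ ∷ _ ∷ _ ∷ l′ ∷ []} eq
    with does (toℕ l ≤? toℕ m) | does (toℕ l′ ≤? toℕ m′)
  ... | true  | true  with m≡ , l≡ , j≡ , i≡ ← ∷-injective₄ (inj₁-injective eq) =
    ∷-cong₄-toℕ (suc-injective m≡) i≡ j≡ l≡
  ... | false | false with l≡ , j≡ , i≡ , m≡ ← ∷-injective₄ (inj₂-injective eq) =
    ∷-cong₄-toℕ m≡ i≡ j≡ l≡
  g-injective {_ ∷ _ ∷ _ ∷ _ ∷ []} {_ ∷ _ ∷ _ ∷ _ ∷ []} () | true  | false
  g-injective {_ ∷ _ ∷ _ ∷ _ ∷ []} {_ ∷ _ ∷ _ ∷ _ ∷ []} () | false | true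
  g-low : ∀ m i j l → l Fin.≤ m → inj₁ (low (m ∷ i ∷ j ∷ l ∷ [])) ≡ g (m ∷ i ∷ j ∷ l ∷ [])
  g-low m i j l l≤m rewrite dec-true (toℕ l ≤? toℕ m) l≤m = refl
  g-high : ∀ m i j l → m Fin.< l → inj₂ (high (m ∷ i ∷ j ∷ l ∷ [])) ≡ g (m ∷ i ∷ j ∷ l ∷ [])
  g-high m i j l m<l rewrite dec-false (toℕ l ≤? toℕ m) (<⇒≱ m<l) = refl
  into : ∀ σ i → IsReflection σ → IsOccurrence p321 σ i →
    g (lookup σ 0F ∷ i) ∈ ys
  into σ is@(i ∷ j ∷ l ∷ []) σ-refl occ@(incr , _)
    -- The outer pair decides the block, since j lies between i and l.
    with descent⁻ (σ-refl i) (σ-refl l) (incr 0F 2F 0<2) (occurrence⇒< p321 σ is occ 2F 0F 0<2)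
  ... | inj₁ l≤m = subst (_∈ ys) (g-low _ i j l l≤m) (∈-++⁺ˡ (∈-map⁺ inj₁
    (∈-descending₄⁺ (incr 0F 1F 0<1) (incr 1F 2F 1<2) (s≤s l≤m) (s≤s (toℕ<n (lookup σ 0F))))))
  ... | inj₂ m<i = subst (_∈ ys) (g-high _ i j l (<-trans m<i (incr 0F 2F 0<2)))
    (∈-++⁺ʳ (map inj₁ (descending (2 + n) 4)) (∈-map⁺ inj₂
      (∈-descending₄⁺ m<i (incr 0F 1F 0<1) (incr 1F 2F 1<2) (toℕ<n l))))
  onto : ∀ {y} → y ∈ ys → ∃ λ m → ∃ λ i → IsOccurrence p321 (reflection m) i × y ≡ g (m ∷ i)
  onto y∈ with ∈-++⁻ (map inj₁ (descending (2 + n) 4)) y∈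
  ... | inj₁ p
    with _ ∷ _ ∷ _ ∷ _ ∷ [] , v∈ , refl ← ∈-map⁻ inj₁ p
    with i<j , j<l , s≤s l≤m , s≤s m<n ← ∈-descending₄⁻ {2 + n} v∈
    with m , refl ← fromℕ<′ m<n
    with l , refl ← fromℕ<′ (≤-<-trans l≤m m<n)
    with j , refl ← fromℕ<′ (<-trans j<l (toℕ<n l))
    with i , refl ← fromℕ<′ (<-trans i<j (toℕ<n j))
    = m , (i ∷ j ∷ l ∷ []) , occurrence321 (reflection m) i<j j<l
        (descent⁺ (reflection-reflects m j) (reflection-reflects m l) j<l (inj₁ l≤m))
        (descent⁺ (reflection-reflects m i) (reflection-reflects m j) i<j (inj₁ (≤-trans (<⇒≤ j<l) l≤m))) ,
      g-low m i j l l≤m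
  ... | inj₂ p
    with _ ∷ _ ∷ _ ∷ _ ∷ [] , v∈ , refl ← ∈-map⁻ inj₂ p
    with m<i , i<j , j<l , l<n ← ∈-descending₄⁻ {1 + n} v∈
    with l , refl ← fromℕ<′ l<n
    with j , refl ← fromℕ<′ (<-trans j<l l<n)
    with i , refl ← fromℕ<′ (<-trans i<j (toℕ<n j))
    with m , refl ← fromℕ<′ (<-trans m<i (toℕ<n i))
    = m , (i ∷ j ∷ l ∷ []) , occurrence321 (reflection m) i<j j<l
        (descent⁺ (reflection-reflects m j) (reflection-reflects m l) j<l (inj₂ (<-trans m<i i<j)))
        (descent⁺ (reflection-reflects m i) (reflection-reflects m j) i<j (inj₂ m<i)) ,
      g-high m i j l (<-trans m<i (<-trans i<j j<l))

-- Binomial identities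

[1+n]C2*2 : ∀ n → (suc n C 2) * 2 ≡ suc n * n
[1+n]C2*2 zero    = refl
[1+n]C2*2 (suc n) = begin
  (suc (suc n) C 2) * 2             ≡⟨ cong (_* 2) (nCk+nC[k+1]≡[n+1]C[k+1] (suc n) 1) ⟨
  (suc n C 1 + suc n C 2) * 2       ≡⟨ *-distribʳ-+ 2 (suc n C 1) (suc n C 2) ⟩
  (suc n C 1) * 2 + (suc n C 2) * 2 ≡⟨ cong₂ _+_ (cong (_* 2) (nC1≡n (suc n))) ([1+n]C2*2 n) ⟩
  suc n * 2 + suc n * n             ≡⟨ identity n ⟩
  suc (suc n) * suc n               ∎
  where
  open ≡-Reasoning
  identity : ∀ n → suc n * 2 + suc n * n ≡ suc (suc n) * suc n
  identity = solve-∀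

-- Multiplying by 3! avoids division, and the offset 2 avoids truncated subtraction in the falling
-- product.
[2+n]C3*6 : ∀ n → ((2 + n) C 3) * 6 ≡ (2 + n) * (1 + n) * n
[2+n]C3*6 zero    = refl
[2+n]C3*6 (suc n) = begin
  ((3 + n) C 3) * 6                             ≡⟨ cong (_* 6) (nCk+nC[k+1]≡[n+1]C[k+1] (2 + n) 2) ⟨
  ((2 + n) C 2 + (2 + n) C 3) * 6               ≡⟨ split ((2 + n) C 2) ((2 + n) C 3) ⟩
  ((2 + n) C 2) * 2 * 3 + ((2 + n) C 3) * 6     ≡⟨ cong₂ _+_ (cong (_* 3) ([1+n]C2*2 (suc n))) ([2+n]C3*6 n) ⟩
  (2 + n) * (1 + n) * 3 + (2 + n) * (1 + n) * n ≡⟨ identity n ⟩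
  (3 + n) * (2 + n) * (1 + n)                 ∎
  where
  open ≡-Reasoning
  split : ∀ a b → (a + b) * 6 ≡ a * 2 * 3 + b * 6
  split = solve-∀
  identity : ∀ n → (2 + n) * (1 + n) * 3 + (2 + n) * (1 + n) * n ≡ (3 + n) * (2 + n) * (1 + n)
  identity = solve-∀

-- The two falling products share (2 + n)(1 + n)n, and their remaining factors 3 + n and n - 1 add
-- up to 2(1 + n), whence 12 instead of 24. The induction applies Pascal's rule to both binomials.
C4-sum*12 : ∀ n → ((3 + n) C 4 + (2 + n) C 4) * 12 ≡ (2 + n) * n * (1 + n) ^ 2
C4-sum*12 zero    = refl
C4-sum*12 (suc n) = begin
  ((4 + n) C 4 + (3 + n) C 4) * 12
    ≡⟨ cong (_* 12) (cong₂ _+_ (nCk+nC[k+1]≡[n+1]C[k+1] (3 + n) 3) (nCk+nC[k+1]≡[n+1]C[k+1] (2 + n) 3)) ⟨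
  ((3 + n) C 3 + (3 + n) C 4 + ((2 + n) C 3 + (2 + n) C 4)) * 12
    ≡⟨ split ((3 + n) C 3) ((3 + n) C 4) ((2 + n) C 3) ((2 + n) C 4) ⟩
  ((3 + n) C 3) * 6 * 2 + ((2 + n) C 3) * 6 * 2 + ((3 + n) C 4 + (2 + n) C 4) * 12
    ≡⟨ cong₂ _+_ (cong₂ _+_ (cong (_* 2) ([2+n]C3*6 (suc n))) (cong (_* 2) ([2+n]C3*6 n))) (C4-sum*12 n) ⟩
  (3 + n) * (2 + n) * (1 + n) * 2 + (2 + n) * (1 + n) * n * 2 + (2 + n) * n * (1 + n) ^ 2
    ≡⟨ identity n ⟩
  (3 + n) * (1 + n) * (2 + n) ^ 2 ∎
  where
  open ≡-Reasoning
  split : ∀ a b c d → (a + b + (c + d)) * 12 ≡ a * 6 * 2 + c * 6 * 2 + (b + d) * 12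
  split = solve-∀
  -- (_^ 2) is unfolded, for the ring solver does not handle it.
  identity : ∀ n → (3 + n) * (2 + n) * (1 + n) * 2 + (2 + n) * (1 + n) * n * 2 + (2 + n) * n * ((1 + n) * ((1 + n) * 1))
    ≡ (3 + n) * (1 + n) * ((2 + n) * ((2 + n) * 1))
  identity = solve-∀

/-from-* : ∀ a b → a * 12 ≡ b → (+ a) / 1 ≡ (+ b) / 12
-- Cross-multiplication suffices for unnormalised fractions; `mkℚᵘ` takes the denominator minus one,
-- so 0 and 11 stand for 1 and 12.
/-from-* a b eq = ℚ.fromℚᵘ-cong {mkℚᵘ (+ a) 0} {mkℚᵘ (+ b) 11}
  (*≡* (trans (sym (ℤ.pos-* a 12)) (trans (cong +_ eq) (sym (ℤ.*-identityʳ (+ b))))))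

theorem3p8 : ∀ (n : ℕ) → n ≥ 3 →
    (f p132 n ≡ (n + 1) C 4) ×
    (f p213 n ≡ (n + 1) C 4) ×
    ((+ f p321 n) / 1 ≡ (+ (n * (n ∸ 2) * (n ∸ 1) ^ 2)) / 12)
-- With the length written as 2 + n, the truncated differences in the statement compute to n and 1 +
-- n.
theorem3p8 (suc (suc n)) (s≤s (s≤s _)) =
  trans (f132 (suc n)) n+1 ,
  trans (f213 (suc n)) n+1 ,
  /-from-* (f p321 (2 + n)) ((2 + n) * n * (1 + n) ^ 2) (trans (cong (_* 12) (f321 (suc n))) (C4-sum*12 n))
  where
  n+1 : (3 + n) C 4 ≡ (2 + n + 1) C 4
  n+1 = cong (_C 4) (+-comm 1 (2 + n))
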